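{- For every positive integer $v$, no $egr(v,4,5,8)$-graph exists. For every positive integer $v$, no $egr(v,6,5,24)$-graph exists.
   Context: Graphs are finite, simple and undirected. For integers $v,k,g,\lambda$, an $egr(v,k,g,\lambda)$-graph (edge-girth-regular graph) is a $k$-regular graph on $v$ vertices with girth $g$ (the length of a shortest cycle is exactly $g$) such that every edge is contained in exactly $\lambda$ cycles of length $g$. -}

module Defs where

open import Data.Nat.Base using (ℕ; suc; _≤_; _<_)
open import Data.Nat.DivMod using (_mod_)
open import Data.Fin.Base using (Fin; toℕ)
open import Data.List.Base using (length; filter; allFin)
open import Data.Product.Base using (Σ-syntax; ∃-syntax; _×_; proj₁)
open import Data.Sum.Base using (_⊎_)
open import Function.Bundles using (Inverse; _⇔_)
open import Function.Definitions using (Injective)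
open import Function.Properties.Equivalence using (⇔-isEquivalence)
open import Level using (0ℓ)
open import Relation.Binary.Bundles using (Setoid)
open import Relation.Binary.Core using (Rel)
open import Relation.Binary.Definitions using (Decidable; Irreflexive; Symmetric)
open import Relation.Binary.PropositionalEquality.Core using (_≡_)
import Relation.Binary.PropositionalEquality.Properties as ≡
open import Relation.Binary.Structures using (IsEquivalence)
import Relation.Binary.Construct.On as On
open import Relation.Nullary.Negation.Core using (¬_)

record Graph (v : ℕ) : Set₁ where
  field
    Adj    : Rel (Fin v) 0ℓ
    Adj?   : Decidable Adj
    sym    : Symmetric Adj
    irrefl : Irreflexive _≡_ Adj

-- Cyclic successor: the last index is sent to zero.
next : ∀ {n} → Fin n → Fin n
next {suc n} i = suc (toℕ i) mod suc n

module _ {v : ℕ} (G : Graph v) where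
  open Graph G

  degree : Fin v → ℕ
  degree x = length (filter (Adj? x) (allFin v))

  Regular : ℕ → Set
  Regular k = ∀ x → degree x ≡ k

  -- A cycle with a chosen starting vertex and direction; these choices are
  -- forgotten by the equality _≈_ below.
  record Cycle (n : ℕ) : Set where
    field
      3≤n       : 3 ≤ n
      vertex    : Fin n → Fin v
      injective : Injective _≡_ _≡_ vertex
      adjacent  : ∀ i → Adj (vertex i) (vertex (next i))

  HasGirth : ℕ → Set
  HasGirth g = Cycle g × (∀ {n} → n < g → ¬ Cycle n)

module _ {v : ℕ} {G : Graph v} {n : ℕ} where

  -- The unordered pair {x, y} is an edge of the cycle C.
  HasEdge : Cycle G n → Rel (Fin v) 0ℓ
  HasEdge C x y = ∃[ i ] ( (vertex i ≡ x × vertex (next i) ≡ y)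
                         ⊎ (vertex i ≡ y × vertex (next i) ≡ x))
    where open Cycle C

  -- Cycles are identified when they are the same subgraph; as cycles have no
  -- isolated vertices, it suffices to compare edges.
  _≈_ : Rel (Cycle G n) 0ℓ
  C ≈ D = ∀ x y → HasEdge C x y ⇔ HasEdge D x y

  ≈-isEquivalence : IsEquivalence _≈_
  ≈-isEquivalence = record
    { refl  = λ x y → ⇔.refl
    ; sym   = λ p x y → ⇔.sym (p x y)
    ; trans = λ p q x y → ⇔.trans (p x y) (q x y)
    }
    where module ⇔ = IsEquivalence (⇔-isEquivalence {0ℓ})

module _ {v : ℕ} (G : Graph v) where
  open Graph G

  CyclesThrough : ℕ → Fin v → Fin v → Setoid 0ℓ 0ℓ
  CyclesThrough n x y = record
    { Carrier       = Σ[ C ∈ Cycle G n ] HasEdge C x y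
    ; _≈_           = λ C D → proj₁ C ≈ proj₁ D
    ; isEquivalence = On.isEquivalence proj₁ ≈-isEquivalence
    }

  record IsEdgeGirthRegular (k g l : ℕ) : Set where
    field
      regular : Regular G k
      girth   : HasGirth G g
      count   : ∀ x y → Adj x y → Inverse (≡.setoid (Fin l)) (CyclesThrough g x y)

egr : (v k g l : ℕ) → Set₁
egr v k g l = Σ[ G ∈ Graph v ] IsEdgeGirthRegular G k g l

{-# OPTIONS --safe #-}
-- Write k = d + 1; the multiplicities in question are λ = d² − 1. For an edge xy, the d² paths
-- x y w z of length 3 close up to 5-cycles in exactly λ cases, so every directed edge starts exactly
-- one bad path, i.e. one whose ends have no common neighbour. If z is the end of a bad path from x,
-- then all neighbours of z but at most one are at distance 2 from x, so z is the end of at least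
-- k − 1 of the k bad paths from x. As 2(k − 1) > k, all of these end at the same vertex z. Hence the
-- component of x is x, its k neighbours, the k(k − 1) vertices at distance 2, and z: it has k² + 2
-- vertices and carries (k² + 2)kλ closed walks of length 5, which are all 5-cycles. Rotation
-- permutes these walks freely, so 5 divides (k² + 2)kλ; but 18·4·8 and 38·6·24 are prime to 5.
module Submission where

open import Defs
open import Data.Bool.Base using (if_then_else_)
open import Data.Empty using (⊥; ⊥-elim)
open import Data.Fin.Base as Fin using (Fin; zero; suc; fromℕ<)
open import Data.Fin.Patterns using (0F; 1F; 2F; 3F; 4F)
import Data.Fin.Properties as Fin
open import Data.List.Base using (length; filter; tabulate)
open import Data.Nat.Base using (ℕ; zero; suc; _+_; _*_; _≤_; _<_; z≤n; s≤s; s≤s⁻¹)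
open import Data.Nat.Divisibility using (_∣_; _∣?_; divides)
open import Data.Nat.Properties
open import Data.Product.Base using (∃; Σ; _×_; _,_; proj₁; proj₂)
open import Data.Sum.Base using (_⊎_; inj₁; inj₂)
open import Function.Base using (_∘_; id)
open import Function.Bundles using (Inverse; Equivalence; mk⇔)
open import Level using (0ℓ)
open import Relation.Binary.PropositionalEquality
open import Relation.Binary.Structures using (IsEquivalence)
open import Relation.Nullary.Decidable.Core
  using (Dec; does; yes; no; ¬?; _×-dec_; _⊎-dec_; toWitness; from-no)
open import Relation.Nullary.Negation.Core using (¬_; contradiction)
open import Relation.Unary using (Pred; Decidable)
open import Algebra.Properties.Semiring.Sum +-*-semiring
  using (sum; sum-cong-≗; ∑-distrib-+; ∑-comm; *-distribʳ-sum)

-- Indicators and counting over finite types.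

⟦_⟧ : {P : Set} → Dec P → ℕ
-- Only `does` is inspected, so a composite decision with one factor known reduces definitionally,
-- without deciding the other factors.
⟦ p? ⟧ = if does p? then 1 else 0

⟦⟧-yes : {P : Set} (p? : Dec P) → P → ⟦ p? ⟧ ≡ 1
⟦⟧-yes (yes _) p = refl
⟦⟧-yes (no ¬p) p = contradiction p ¬p

⟦⟧-no : {P : Set} (p? : Dec P) → ¬ P → ⟦ p? ⟧ ≡ 0
⟦⟧-no (yes p) ¬p = contradiction p ¬p
⟦⟧-no (no _)  ¬p = refl

⟦⟧-cong : {P Q : Set} (p? : Dec P) (q? : Dec Q) → (P → Q) → (Q → P) → ⟦ p? ⟧ ≡ ⟦ q? ⟧
⟦⟧-cong p? (yes q) f g = ⟦⟧-yes p? (g q)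
⟦⟧-cong p? (no ¬q) f g = ⟦⟧-no p? (¬q ∘ f)

⟦⟧-inv : {P : Set} (p? : Dec P) → ⟦ p? ⟧ ≢ 0 → P
⟦⟧-inv (yes p) _ = p
⟦⟧-inv (no _)  h = contradiction refl h

count : ∀ {n} {P : Pred (Fin n) 0ℓ} → Decidable P → ℕ
count P? = sum (λ i → ⟦ P? i ⟧)

length-filter-tabulate : ∀ {n} {A : Set} {P : Pred A 0ℓ} (P? : Decidable P) (f : Fin n → A) →
                         length (filter P? (tabulate f)) ≡ count (P? ∘ f)
length-filter-tabulate {zero}  P? f = refl
length-filter-tabulate {suc n} P? f with P? (f zero)
... | yes _ = cong suc (length-filter-tabulate P? (f ∘ suc))
... | no  _ = length-filter-tabulate P? (f ∘ suc)

sum≡0 : ∀ {n} (f : Fin n → ℕ) → (∀ i → f i ≡ 0) → sum f ≡ 0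
sum≡0 {zero}  f h = refl
sum≡0 {suc n} f h = cong₂ _+_ (h zero) (sum≡0 (f ∘ suc) (h ∘ suc))

sum-mono-≤ : ∀ {n} (f g : Fin n → ℕ) → (∀ i → f i ≤ g i) → sum f ≤ sum g
sum-mono-≤ {zero}  f g h = z≤n
sum-mono-≤ {suc n} f g h = +-mono-≤ (h zero) (sum-mono-≤ (f ∘ suc) (g ∘ suc) (h ∘ suc))

≤-sum : ∀ {n} (f : Fin n → ℕ) i → f i ≤ sum f
≤-sum f zero    = m≤m+n _ _
≤-sum f (suc i) = ≤-trans (≤-sum (f ∘ suc) i) (m≤n+m _ _)

+-≤-sum : ∀ {n} (f : Fin n → ℕ) {i j} → i ≢ j → f i + f j ≤ sum f
+-≤-sum f {zero}  {zero}  i≢j = contradiction refl i≢j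
+-≤-sum f {zero}  {suc j} i≢j = +-monoʳ-≤ (f zero) (≤-sum (f ∘ suc) j)
+-≤-sum f {suc i} {zero}  i≢j =
  subst (_≤ sum f) (+-comm (f zero) _) (+-monoʳ-≤ (f zero) (≤-sum (f ∘ suc) i))
+-≤-sum f {suc i} {suc j} i≢j =
  ≤-trans (+-≤-sum (f ∘ suc) (i≢j ∘ cong suc)) (m≤n+m _ _)

sum≢0⇒∃ : ∀ {n} (f : Fin n → ℕ) → sum f ≢ 0 → ∃ λ i → f i ≢ 0
sum≢0⇒∃ {zero}  f h = contradiction refl h
sum≢0⇒∃ {suc n} f h with f zero in eq
... | suc _ = zero , λ e → contradiction (trans (sym eq) e) λ ()
... | zero with sum≢0⇒∃ (f ∘ suc) h
...   | i , fi≢0 = suc i , fi≢0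

count≡0 : ∀ {n} {P : Pred (Fin n) 0ℓ} (P? : Decidable P) → (∀ i → ¬ P i) → count P? ≡ 0
count≡0 P? ¬P = sum≡0 _ (λ i → ⟦⟧-no (P? i) (¬P i))

count-cong : ∀ {n} {P Q : Pred (Fin n) 0ℓ} (P? : Decidable P) (Q? : Decidable Q) →
             (∀ i → P i → Q i) → (∀ i → Q i → P i) → count P? ≡ count Q?
count-cong P? Q? f g = sum-cong-≗ (λ i → ⟦⟧-cong (P? i) (Q? i) (f i) (g i))

-- Peels one known element off a count. This is the step from k neighbours to the k - 1 ways of
-- continuing a path without turning back.
count-≢ : ∀ {n} {P : Pred (Fin n) 0ℓ} (P? : Decidable P) {i} → P i →
          suc (count (λ j → P? j ×-dec ¬? (j Fin.≟ i))) ≡ count P?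
count-≢ {suc n} P? {zero} p = cong₂ _+_
  (trans (cong suc (⟦⟧-no (P? zero ×-dec ¬? (zero {n} Fin.≟ zero)) λ (_ , 0≢0) → 0≢0 refl)) (sym (⟦⟧-yes (P? zero) p)))
  (sum-cong-≗ λ j → ⟦⟧-cong (P? (suc j) ×-dec ¬? (suc j Fin.≟ zero)) (P? (suc j)) (λ (q , _) → q) (λ q → q , λ ()))
count-≢ P? {suc i} p = trans (sym (+-suc _ _)) (cong₂ _+_
  (⟦⟧-cong (P? zero ×-dec ¬? (zero Fin.≟ suc i)) (P? zero) (λ (q , _) → q) (λ q → q , λ ()))
  (trans (cong suc (count-cong (λ j → P? (suc j) ×-dec ¬? (suc j Fin.≟ suc i)) (λ j → P? (suc j) ×-dec ¬? (j Fin.≟ i))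
            (λ j (q , ne) → q , λ e → ne (cong suc e)) (λ j (q , ne) → q , λ e → ne (Fin.suc-injective e))))
         (count-≢ (P? ∘ suc) p)))

count≡1 : ∀ {n} {P : Pred (Fin n) 0ℓ} (P? : Decidable P) {i} → P i → (∀ j → P j → j ≡ i) → count P? ≡ 1
count≡1 P? {i} p uniq = trans (sym (count-≢ P? p))
  (cong suc (count≡0 (λ j → P? j ×-dec ¬? (j Fin.≟ i)) λ j (q , ne) → ne (uniq j q)))

count≤1 : ∀ {n} {P : Pred (Fin n) 0ℓ} (P? : Decidable P) → (∀ i j → P i → P j → i ≡ j) → count P? ≤ 1
count≤1 P? uniq with Fin.any? P?
... | yes (i , p) = ≤-reflexive (count≡1 P? p λ j q → uniq j i q p)
... | no ¬∃       = ≤-trans (≤-reflexive (count≡0 P? λ i p → ¬∃ (i , p))) z≤n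

count-guard : ∀ {n} {A : Set} {P : Pred (Fin n) 0ℓ} (a? : Dec A) (P? : Decidable P) {m} →
              (A → count P? ≡ m) → count (λ i → a? ×-dec P? i) ≡ ⟦ a? ⟧ * m
count-guard (yes a) P? h = trans (count-cong (λ i → yes a ×-dec P? i) P? (λ i (_ , p) → p) (λ i p → a , p))
                                 (trans (h a) (sym (*-identityˡ _)))
count-guard (no ¬a) P? h = count≡0 (λ i → no ¬a ×-dec P? i) (λ i (a , _) → ¬a a)

sum-⟦⟧* : ∀ {n} {P : Pred (Fin n) 0ℓ} (P? : Decidable P) m → sum (λ i → ⟦ P? i ⟧ * m) ≡ count P? * m
sum-⟦⟧* P? m = sym (*-distribʳ-sum m (λ i → ⟦ P? i ⟧))

-- Product rule for dependent choices: the number of second choices has to be constant only over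
-- admissible first choices, because a failed guard contributes zero.
count₂ : ∀ {m n} {P : Pred (Fin m) 0ℓ} {Q : Fin m → Pred (Fin n) 0ℓ}
         (P? : Decidable P) (Q? : ∀ i → Decidable (Q i)) {a b} →
         count P? ≡ a → (∀ i → P i → count (Q? i) ≡ b) →
         sum (λ i → count (λ j → P? i ×-dec Q? i j)) ≡ a * b
count₂ P? Q? {b = b} p q = trans (sum-cong-≗ λ i → count-guard (P? i) (Q? i) (q i))
                          (trans (sum-⟦⟧* P? b) (cong (_* b) p))

-- Symmetries of the pentagon, checked by finite decision.

pred₅ : Fin 5 → Fin 5
pred₅ 0F = 4F
pred₅ 1F = 0F
pred₅ 2F = 1F
pred₅ 3F = 2F
pred₅ 4F = 3F

next-pred₅ : ∀ i → next (pred₅ i) ≡ i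
next-pred₅ = toWitness {a? = Fin.all? λ i → next (pred₅ i) Fin.≟ i} _

pred₅-next : ∀ i → pred₅ (next i) ≡ i
pred₅-next = toWitness {a? = Fin.all? λ i → pred₅ (next i) Fin.≟ i} _

next-injective₅ : ∀ {i j : Fin 5} → next i ≡ next j → i ≡ j
next-injective₅ {i} {j} e = trans (sym (pred₅-next i)) (trans (cong pred₅ e) (pred₅-next j))

-- The reflection sending i to 1 - i modulo 5; it swaps the ends of the edge from 0 to 1.
flip₅ : Fin 5 → Fin 5
flip₅ 0F = 1F
flip₅ 1F = 0F
flip₅ 2F = 4F
flip₅ 3F = 3F
flip₅ 4F = 2F

flip₅-involutive : ∀ i → flip₅ (flip₅ i) ≡ i
flip₅-involutive = toWitness {a? = Fin.all? λ i → flip₅ (flip₅ i) Fin.≟ i} _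

next-flip₅-next : ∀ i → next (flip₅ (next i)) ≡ flip₅ i
next-flip₅-next = toWitness {a? = Fin.all? λ i → next (flip₅ (next i)) Fin.≟ flip₅ i} _

next-next≢₅ : ∀ (i : Fin 5) → next (next i) ≢ i
next-next≢₅ = toWitness {a? = Fin.all? λ i → ¬? (next (next i) Fin.≟ i)} _

-- The difference j - i is 0, 1, 2, -2 or -1 modulo 5; negative differences are written from the
-- side of j, so that symmetric cases can share an argument.
Fin5-orbit : ∀ (i j : Fin 5) → (j ≡ i) ⊎ (j ≡ next i) ⊎ (j ≡ next (next i))
                             ⊎ (i ≡ next (next j)) ⊎ (i ≡ next j)
Fin5-orbit = toWitness {a? = Fin.all? λ i → Fin.all? λ j → (j Fin.≟ i) ⊎-dec (j Fin.≟ next i)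
  ⊎-dec (j Fin.≟ next (next i)) ⊎-dec (i Fin.≟ next (next j)) ⊎-dec (i Fin.≟ next j)} _

next⁵ : ∀ (i : Fin 5) → next (next (next (next (next i)))) ≡ i
next⁵ = toWitness {a? = Fin.all? λ i → next (next (next (next (next i)))) Fin.≟ i} _

⟨_,_,_,_,_⟩ : {A : Set} → A → A → A → A → A → Fin 5 → A
⟨ a , b , c , d , e ⟩ 0F = a
⟨ a , b , c , d , e ⟩ 1F = b
⟨ a , b , c , d , e ⟩ 2F = c
⟨ a , b , c , d , e ⟩ 3F = d
⟨ a , b , c , d , e ⟩ 4F = e

-- Short cycles and closed 5-walks in a graph of girth 5.

module Girth5 {v : ℕ} (G : Graph v) (girth : HasGirth G 5) where
  open Graph G public renaming (sym to Adj-sym)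
  private V = Fin v

  Adj⇒≢ : ∀ {x y} → Adj x y → x ≢ y
  Adj⇒≢ xy e = irrefl e xy

  no-triangle : ∀ {x y z} → Adj x y → Adj y z → Adj z x → ⊥
  no-triangle {x} {y} {z} xy yz zx = proj₂ girth {3} (s≤s (s≤s (s≤s (s≤s z≤n)))) record
    { 3≤n = s≤s (s≤s (s≤s z≤n)) ; vertex = t ; injective = λ {i} {j} → inj i j ; adjacent = adj }
    where
    t : Fin 3 → V
    t 0F = x
    t 1F = y
    t 2F = z
    inj : ∀ i j → t i ≡ t j → i ≡ j
    inj 0F 0F e = refl
    inj 0F 1F e = contradiction e (Adj⇒≢ xy)
    inj 0F 2F e = contradiction (sym e) (Adj⇒≢ zx)
    inj 1F 0F e = contradiction (sym e) (Adj⇒≢ xy)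
    inj 1F 1F e = refl
    inj 1F 2F e = contradiction e (Adj⇒≢ yz)
    inj 2F 0F e = contradiction e (Adj⇒≢ zx)
    inj 2F 1F e = contradiction (sym e) (Adj⇒≢ yz)
    inj 2F 2F e = refl
    adj : ∀ i → Adj (t i) (t (next i))
    adj 0F = xy
    adj 1F = yz
    adj 2F = zx

  no-quadrangle : ∀ {x y z u} → Adj x y → Adj y z → Adj z u → Adj u x → x ≢ z → y ≢ u → ⊥
  no-quadrangle {x} {y} {z} {u} xy yz zu ux x≢z y≢u = proj₂ girth {4} (s≤s (s≤s (s≤s (s≤s (s≤s z≤n))))) record
    { 3≤n = s≤s (s≤s (s≤s z≤n)) ; vertex = t ; injective = λ {i} {j} → inj i j ; adjacent = adj }
    where
    t : Fin 4 → V
    t 0F = x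
    t 1F = y
    t 2F = z
    t 3F = u
    inj : ∀ i j → t i ≡ t j → i ≡ j
    inj 0F 0F e = refl
    inj 0F 1F e = contradiction e (Adj⇒≢ xy)
    inj 0F 2F e = contradiction e x≢z
    inj 0F 3F e = contradiction (sym e) (Adj⇒≢ ux)
    inj 1F 0F e = contradiction (sym e) (Adj⇒≢ xy)
    inj 1F 1F e = refl
    inj 1F 2F e = contradiction e (Adj⇒≢ yz)
    inj 1F 3F e = contradiction e y≢u
    inj 2F 0F e = contradiction (sym e) x≢z
    inj 2F 1F e = contradiction (sym e) (Adj⇒≢ yz)
    inj 2F 2F e = refl
    inj 2F 3F e = contradiction e (Adj⇒≢ zu)
    inj 3F 0F e = contradiction e (Adj⇒≢ ux)
    inj 3F 1F e = contradiction (sym e) y≢u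
    inj 3F 2F e = contradiction (sym e) (Adj⇒≢ zu)
    inj 3F 3F e = refl
    adj : ∀ i → Adj (t i) (t (next i))
    adj 0F = xy
    adj 1F = yz
    adj 2F = zu
    adj 3F = ux

  common-unique : ∀ {x z y y'} → x ≢ z → Adj x y → Adj y z → Adj x y' → Adj y' z → y ≡ y'
  common-unique {y = y} {y'} x≢z xy yz xy' y'z with y Fin.≟ y'
  ... | yes e  = e
  ... | no  ne = ⊥-elim (no-quadrangle xy yz (Adj-sym y'z) (Adj-sym xy') x≢z ne)

  Closed : (Fin 5 → V) → Set
  Closed t = ∀ i → Adj (t i) (t (next i))

  -- If positions i and i + 2 coincided, the other three steps of the walk would form a triangle.
  closed-next² : ∀ {t} → Closed t → ∀ i → t i ≢ t (next (next i))
  closed-next² {t} c i e = no-triangle (c (next (next i))) (c _)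
    (subst₂ Adj refl (trans (cong t (next⁵ i)) e) (c (next (next (next (next i))))))

  -- Lets 5-cycles be counted as closed walks: two positions on the pentagon are equal, one step
  -- apart or two steps apart, and the last two options are excluded by adjacency and by
  -- `closed-next²`.
  closed-injective : ∀ {t} → Closed t → ∀ {i j} → t i ≡ t j → i ≡ j
  closed-injective {t} c {i} {j} e with Fin5-orbit i j
  ... | inj₁ refl                                = refl
  ... | inj₂ (inj₁ refl)                         = ⊥-elim (Adj⇒≢ (c i) e)
  ... | inj₂ (inj₂ (inj₁ refl))                  = ⊥-elim (closed-next² c i e)
  ... | inj₂ (inj₂ (inj₂ (inj₁ refl)))           = ⊥-elim (closed-next² c j (sym e))
  ... | inj₂ (inj₂ (inj₂ (inj₂ refl)))           = ⊥-elim (Adj⇒≢ (c j) (sym e))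

  -- Rotating and reflecting 5-cycles to start along a prescribed edge.

  private
    C₅ = Cycle G 5
    open Cycle

  -- _≈_ unfolds to a statement about edges, from which the cycles cannot be inferred.
  ≈-refl : ∀ (C : C₅) → C ≈ C
  ≈-refl C = IsEquivalence.refl ≈-isEquivalence {x = C}

  ≈-sym : ∀ (C D : C₅) → C ≈ D → D ≈ C
  ≈-sym C D = IsEquivalence.sym ≈-isEquivalence {C} {D}

  ≈-trans : ∀ (C D E : C₅) → C ≈ D → D ≈ E → C ≈ E
  ≈-trans C D E = IsEquivalence.trans ≈-isEquivalence {C} {D} {E}

  closedCycle : (t : Fin 5 → V) → Closed t → C₅
  closedCycle t c = record { 3≤n = s≤s (s≤s (s≤s z≤n)) ; vertex = t ; injective = closed-injective c ; adjacent = c }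

  rotate : C₅ → C₅
  rotate C = closedCycle (vertex C ∘ next) (adjacent C ∘ next)

  rotate-≈ : ∀ C → rotate C ≈ C
  rotate-≈ C x y = mk⇔ (λ (i , h) → next i , h) from
    where
    from : HasEdge C x y → HasEdge (rotate C) x y
    from (i , h) = pred₅ i , subst (λ j → (vertex C j ≡ x × vertex C (next j) ≡ y) ⊎
                                          (vertex C j ≡ y × vertex C (next j) ≡ x))
                                    (sym (next-pred₅ i)) h

  reflect : C₅ → C₅
  reflect C = closedCycle (vertex C ∘ flip₅) λ i →
    Adj-sym (subst (Adj _) (cong (vertex C) (next-flip₅-next i)) (adjacent C (flip₅ (next i))))

  reflect-edges : ∀ C {x y} → HasEdge (reflect C) x y → HasEdge C x y
  reflect-edges C (i , inj₁ (p , q)) = flip₅ (next i) , inj₂ (q , trans (cong (vertex C) (next-flip₅-next i)) p)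
  reflect-edges C (i , inj₂ (p , q)) = flip₅ (next i) , inj₁ (q , trans (cong (vertex C) (next-flip₅-next i)) p)

  ≗⇒≈ : ∀ (C D : C₅) → vertex C ≗ vertex D → C ≈ D
  ≗⇒≈ C D h x y = mk⇔ (go C D h) (go D C (sym ∘ h))
    where
    go : ∀ (C D : C₅) → vertex C ≗ vertex D → HasEdge C x y → HasEdge D x y
    go C D h (i , inj₁ (p , q)) = i , inj₁ (trans (sym (h i)) p , trans (sym (h (next i))) q)
    go C D h (i , inj₂ (p , q)) = i , inj₂ (trans (sym (h i)) p , trans (sym (h (next i))) q)

  reflect-≈ : ∀ C → reflect C ≈ C
  reflect-≈ C x y = mk⇔ (reflect-edges C) λ h → reflect-edges (reflect C)
    (Equivalence.from (≗⇒≈ (reflect (reflect C)) C (λ i → cong (vertex C) (flip₅-involutive i)) x y) h)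

  Based : V → V → C₅ → Set
  Based x y C = vertex C 0F ≡ x × vertex C 1F ≡ y

  Rebased : V → V → C₅ → Set
  Rebased x y C = Σ C₅ λ D → D ≈ C × Based x y D

  rotate-to : ∀ C i → Rebased (vertex C i) (vertex C (next i)) C
  rotate-to C 0F = C , ≈-refl C , refl , refl
  rotate-to C (suc i) = go i
    where
    C₁ = rotate C
    C₂ = rotate C₁
    C₃ = rotate C₂
    C₄ = rotate C₃
    C₂≈C : C₂ ≈ C
    C₂≈C = ≈-trans C₂ C₁ C (rotate-≈ C₁) (rotate-≈ C)
    C₃≈C : C₃ ≈ C
    C₃≈C = ≈-trans C₃ C₂ C (rotate-≈ C₂) C₂≈C
    go : ∀ i → Rebased (vertex C (suc i)) (vertex C (next (suc i))) C
    go 0F = C₁ , rotate-≈ C , refl , refl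
    go 1F = C₂ , C₂≈C , refl , refl
    go 2F = C₃ , C₃≈C , refl , refl
    go 3F = C₄ , ≈-trans C₄ C₃ C (rotate-≈ C₃) C₃≈C , refl , refl

  -- Together with `based-agree`, this gives every class of cycles through xy exactly one
  -- representative, up to pointwise equality, that starts x, y.
  rebase : ∀ {x y} C → HasEdge C x y → Rebased x y C
  rebase C (i , inj₁ (p , q)) with rotate-to C i
  ... | D , D≈C , d₀ , d₁ = D , D≈C , trans d₀ p , trans d₁ q
  rebase C (i , inj₂ (p , q)) with rotate-to C i
  ... | D , D≈C , d₀ , d₁ =
    reflect D , ≈-trans (reflect D) D C (reflect-≈ D) D≈C , trans d₁ q , trans d₀ p

  -- Two consecutive vertices and the edge set determine a cycle: the next vertex is reached by the
  -- one edge at the current vertex that does not lead back.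
  based-agree : ∀ {x y} (C D : C₅) → C ≈ D → Based x y C → Based x y D → vertex C ≗ vertex D
  based-agree C D C≈D (c₀ , c₁) (d₀ , d₁) =
    λ { 0F → a₀ ; 1F → a₁ ; 2F → a₂ ; 3F → a₃ ; 4F → step 2F a₂ a₃ }
    where
    step : ∀ i → vertex C i ≡ vertex D i → vertex C (next i) ≡ vertex D (next i) →
           vertex C (next (next i)) ≡ vertex D (next (next i))
    step i a b with Equivalence.to (C≈D (vertex C (next i)) (vertex C (next (next i)))) (next i , inj₁ (refl , refl))
    ... | j , inj₁ (p , q) with injective D {j} {next i} (trans p b)
    ...   | refl = sym q
    -- Used in the reverse direction, the matching edge of `D` would be its edge number i, so `C`
    -- would be back at its vertex i after two steps.
    step i a b | j , inj₂ (p , q) with next-injective₅ {j} {i} (injective D {next j} {next i} (trans q b))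
    ...   | refl = contradiction (sym (injective C {i} {next (next i)} (trans a p))) (next-next≢₅ i)
    a₀ : vertex C 0F ≡ vertex D 0F
    a₀ = trans c₀ (sym d₀)
    a₁ : vertex C 1F ≡ vertex D 1F
    a₁ = trans c₁ (sym d₁)
    a₂ : vertex C 2F ≡ vertex D 2F
    a₂ = step 0F a₀ a₁
    a₃ : vertex C 3F ≡ vertex D 3F
    a₃ = step 1F a₁ a₂

  -- Cycles through an edge counted as closed walks.

  Walk : V → V → V → V → V → Set
  -- The edge xy itself is supplied separately; these are the four steps that complete it to a
  -- closed walk.
  Walk x y w z q = Adj y w × Adj w z × Adj z q × Adj q x

  Walk? : ∀ x y w z q → Dec (Walk x y w z q)
  Walk? x y w z q = Adj? y w ×-dec Adj? w z ×-dec Adj? z q ×-dec Adj? q x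

  walks : V → V → ℕ
  walks x y = sum λ w → sum λ z → count (Walk? x y w z)

  -- Double counting of the relation `Match` between indices and triples w, z, q: a triple that
  -- completes a walk matches exactly one index, any other triple none, and every index matches
  -- exactly one triple.
  walks≡ : ∀ {l x y} → Inverse (setoid (Fin l)) (CyclesThrough G 5 x y) → Adj x y → walks x y ≡ l
  walks≡ {l} {x} {y} I xy = begin
    (sum λ w → sum λ z → sum λ q → ⟦ Walk? x y w z q ⟧)
      ≡⟨ (sum-cong-≗ λ w → sum-cong-≗ λ z → sum-cong-≗ λ q → pointwise w z q) ⟩
    (sum λ w → sum λ z → sum λ q → sum λ i → ⟦ Match? i w z q ⟧)
      ≡⟨ (sum-cong-≗ λ w → sum-cong-≗ λ z → ∑-comm (λ q i → ⟦ Match? i w z q ⟧)) ⟩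
    (sum λ w → sum λ z → sum λ i → sum λ q → ⟦ Match? i w z q ⟧)
      ≡⟨ (sum-cong-≗ λ w → ∑-comm (λ z i → sum λ q → ⟦ Match? i w z q ⟧)) ⟩
    (sum λ w → sum λ i → sum λ z → sum λ q → ⟦ Match? i w z q ⟧)
      ≡⟨ ∑-comm (λ w i → sum λ z → sum λ q → ⟦ Match? i w z q ⟧) ⟩
    (sum λ i → sum λ w → sum λ z → sum λ q → ⟦ Match? i w z q ⟧)
      ≡⟨ sum-cong-≗ single ⟩
    (sum λ (i : Fin l) → 1)
      ≡⟨ ones l ⟩
    l ∎
    where
    open ≡-Reasoning
    open Inverse I using (to; from; strictlyInverseˡ; strictlyInverseʳ; from-cong)
    based : ∀ i → Rebased x y (proj₁ (to i))
    based i = rebase (proj₁ (to i)) (proj₂ (to i))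
    D : Fin l → C₅
    D i = proj₁ (based i)
    D≈to : ∀ i → D i ≈ proj₁ (to i)
    D≈to i = proj₁ (proj₂ (based i))
    D-based : ∀ i → Based x y (D i)
    D-based i = proj₂ (proj₂ (based i))

    Match : Fin l → V → V → V → Set
    Match i w z q = vertex (D i) 2F ≡ w × vertex (D i) 3F ≡ z × vertex (D i) 4F ≡ q
    Match? : ∀ i w z q → Dec (Match i w z q)
    Match? i w z q = (vertex (D i) 2F Fin.≟ w) ×-dec (vertex (D i) 3F Fin.≟ z) ×-dec (vertex (D i) 4F Fin.≟ q)

    match-unique : ∀ {w z q} i j → Match i w z q → Match j w z q → j ≡ i
    match-unique i j (i₂ , i₃ , i₄) (j₂ , j₃ , j₄) =
      -- Cycles with the same based representative are equivalent, and `from` sends equivalent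
      -- cycles to equal indices.
      trans (sym (strictlyInverseʳ j)) (trans (from-cong {to j} {to i} to-j≈to-i) (strictlyInverseʳ i))
      where
      agree : vertex (D j) ≗ vertex (D i)
      agree 0F = trans (proj₁ (D-based j)) (sym (proj₁ (D-based i)))
      agree 1F = trans (proj₂ (D-based j)) (sym (proj₂ (D-based i)))
      agree 2F = trans j₂ (sym i₂)
      agree 3F = trans j₃ (sym i₃)
      agree 4F = trans j₄ (sym i₄)
      to-j≈to-i : proj₁ (to j) ≈ proj₁ (to i)
      to-j≈to-i = ≈-trans (proj₁ (to j)) (D j) (proj₁ (to i)) (≈-sym (D j) (proj₁ (to j)) (D≈to j))
        (≈-trans (D j) (D i) (proj₁ (to i)) (≗⇒≈ (D j) (D i) agree) (D≈to i))

    match-walk : ∀ {w z q} i → Match i w z q → Walk x y w z q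
    match-walk i (refl , refl , refl) =
      subst (λ u → Adj u (vertex (D i) 2F)) (proj₂ (D-based i)) (adjacent (D i) 1F) , adjacent (D i) 2F ,
      adjacent (D i) 3F , subst (Adj (vertex (D i) 4F)) (proj₁ (D-based i)) (adjacent (D i) 4F)

    walk-match : ∀ {w z q} → Walk x y w z q → ∃ λ i → Match i w z q
    walk-match {w} {z} {q} (yw , wz , zq , qx) = i , agree 2F , agree 3F , agree 4F
      where
      E : C₅
      E = closedCycle ⟨ x , y , w , z , q ⟩ λ { 0F → xy ; 1F → yw ; 2F → wz ; 3F → zq ; 4F → qx }
      E-edge : HasEdge E x y
      E-edge = 0F , inj₁ (refl , refl)
      i = from (E , E-edge)
      agree : vertex (D i) ≗ vertex E
      agree = based-agree (D i) E (≈-trans (D i) (proj₁ (to i)) E (D≈to i) (strictlyInverseˡ (E , E-edge))) (D-based i) (refl , refl)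

    pointwise : ∀ w z q → ⟦ Walk? x y w z q ⟧ ≡ count (λ i → Match? i w z q)
    pointwise w z q = by-cases (Walk? x y w z q)
      where
      by-cases : (d : Dec (Walk x y w z q)) → ⟦ d ⟧ ≡ count (λ i → Match? i w z q)
      by-cases (no ¬walk) = sym (count≡0 (λ i → Match? i w z q) λ i m → ¬walk (match-walk i m))
      by-cases (yes walk) with walk-match walk
      ... | i , m = sym (count≡1 (λ i → Match? i w z q) m λ j → match-unique i j m)

    single-≡ : ∀ (a : V) → count (λ u → a Fin.≟ u) ≡ 1
    single-≡ a = count≡1 (λ u → a Fin.≟ u) refl (λ j e → sym e)

    single : ∀ i → (sum λ w → sum λ z → sum λ q → ⟦ Match? i w z q ⟧) ≡ 1
    single i = trans (sum-cong-≗ λ w → trans (sum-cong-≗ λ z → innermost w z) (inner w)) outer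
      where
      a = vertex (D i) 2F
      b = vertex (D i) 3F
      c = vertex (D i) 4F
      innermost : ∀ w z → (sum λ q → ⟦ Match? i w z q ⟧) ≡ ⟦ (a Fin.≟ w) ×-dec (b Fin.≟ z) ⟧
      innermost w z = trans
        (count-cong (Match? i w z) (λ q → ((a Fin.≟ w) ×-dec (b Fin.≟ z)) ×-dec (c Fin.≟ q))
          (λ _ (p , q , r) → (p , q) , r) (λ _ ((p , q) , r) → p , q , r))
        (trans (count-guard ((a Fin.≟ w) ×-dec (b Fin.≟ z)) (c Fin.≟_) (λ _ → single-≡ c)) (*-identityʳ _))
      inner : ∀ w → count (λ z → (a Fin.≟ w) ×-dec (b Fin.≟ z)) ≡ ⟦ a Fin.≟ w ⟧
      inner w = trans (count-guard (a Fin.≟ w) (b Fin.≟_) (λ _ → single-≡ b)) (*-identityʳ _)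
      outer : count (a Fin.≟_) ≡ 1
      outer = single-≡ a

    ones : ∀ n → (sum λ (i : Fin n) → 1) ≡ n
    ones zero    = refl
    ones (suc n) = cong suc (ones n)

-- Bad paths, where k = d + 1 and l = d² - 1.

module Defect1 {v : ℕ} (G : Graph v) (girth : HasGirth G 5) (d l : ℕ) (2≤d : 2 ≤ d) (1+l≡d² : suc l ≡ d * d)
               (degree≡ : ∀ x → count (Graph.Adj? G x) ≡ suc d)
               (walks≡l : ∀ {x y} → Graph.Adj G x y → Girth5.walks G girth x y ≡ l) where
  open Girth5 G girth
  private V = Fin v

  -- Besides the vertices at distance two from x, this holds of x itself as soon as x has a
  -- neighbour.
  Common : V → V → Set
  Common x z = ∃ λ y → Adj x y × Adj y z

  Common? : ∀ x z → Dec (Common x z)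
  Common? x z = Fin.any? λ y → Adj? x y ×-dec Adj? y z

  Common-sym : ∀ {x z} → Common x z → Common z x
  Common-sym (y , xy , yz) = y , Adj-sym yz , Adj-sym xy

  AdjBut : V → V → V → Set
  AdjBut x y z = Adj x z × z ≢ y

  AdjBut? : ∀ x y z → Dec (AdjBut x y z)
  AdjBut? x y z = Adj? x z ×-dec ¬? (z Fin.≟ y)

  count-AdjBut : ∀ {x y} → Adj x y → count (AdjBut? x y) ≡ d
  count-AdjBut {x} {y} xy = suc-injective (trans (count-≢ (Adj? x) xy) (degree≡ x))

  Path : V → V → V → V → Set
  Path x y w z = AdjBut y x w × AdjBut w y z

  Path? : ∀ x y w z → Dec (Path x y w z)
  Path? x y w z = AdjBut? y x w ×-dec AdjBut? w y z

  paths≡ : ∀ {x y} → Adj x y → (sum λ w → count (Path? x y w)) ≡ d * d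
  paths≡ {x} {y} xy = count₂ (AdjBut? y x) (λ w → AdjBut? w y) (count-AdjBut (Adj-sym xy))
                             (λ w (yw , _) → count-AdjBut (Adj-sym yw))

  Bad : V → V → V → V → Set
  Bad x y w z = Adj x y × Path x y w z × ¬ Common x z

  Bad? : ∀ x y w z → Dec (Bad x y w z)
  Bad? x y w z = Adj? x y ×-dec Path? x y w z ×-dec ¬? (Common? x z)

  Bad-sym : ∀ {x y w z} → Bad x y w z → Bad z w y x
  Bad-sym (xy , ((yw , w≢x) , (wz , z≢y)) , far) =
    Adj-sym wz , ((Adj-sym yw , ≢-sym z≢y) , (Adj-sym xy , ≢-sym w≢x)) , far ∘ Common-sym

  Bad⇒≁ : ∀ {x y w z} → Bad x y w z → ¬ Adj x z
  Bad⇒≁ (xy , ((yw , w≢x) , (wz , z≢y)) , far) xz =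
    no-quadrangle xy yw wz (Adj-sym xz) (≢-sym w≢x) (≢-sym z≢y)

  path-ends≢ : ∀ {x y w z} → Adj x y → Path x y w z → x ≢ z
  path-ends≢ xy ((yw , _) , (wz , _)) refl = no-triangle xy yw wz

  -- A path whose ends have a common neighbour closes to a 5-cycle in one way only, since a second
  -- common neighbour would give a quadrangle; a path without one is bad and does not close.
  bad+walks : ∀ {x y} → Adj x y → ∀ w z → ⟦ Bad? x y w z ⟧ + count (Walk? x y w z) ≡ ⟦ Path? x y w z ⟧
  bad+walks {x} {y} xy w z = by-cases (Path? x y w z) (Common? x z)
    where
    by-cases : (p? : Dec (Path x y w z)) → Dec (Common x z) →
               ⟦ Bad? x y w z ⟧ + count (Walk? x y w z) ≡ ⟦ p? ⟧
    by-cases (no ¬path) _ = cong₂ _+_ (⟦⟧-no (Bad? x y w z) λ (_ , path , _) → ¬path path)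
      -- A closed walk that turned back at y or at w would contain a triangle, so every completion
      -- is already a path.
      (count≡0 (Walk? x y w z) λ q (yw , wz , zq , qx) → ¬path
        ( (yw , λ { refl → no-triangle wz zq qx })
        , (wz , λ { refl → no-triangle xy zq qx }) ))
    by-cases (yes path@((yw , _) , (wz , _))) (yes (q , xq , qz)) =
      cong₂ _+_ (⟦⟧-no (Bad? x y w z) λ (_ , _ , far) → far (q , xq , qz))
        (count≡1 (Walk? x y w z) (yw , wz , Adj-sym qz , Adj-sym xq)
          λ j (_ , _ , zj , jx) → common-unique (path-ends≢ xy path) (Adj-sym jx) (Adj-sym zj) xq qz)
    by-cases (yes path) (no far) =
      cong₂ _+_ (⟦⟧-yes (Bad? x y w z) (xy , path , far))
        (count≡0 (Walk? x y w z) λ q (_ , _ , zq , qx) → far (q , Adj-sym qx , Adj-sym zq))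

  -- Summing `bad+walks` splits the d² paths into the bad ones and the l closing ones; cancelling l
  -- leaves one.
  bad≡1 : ∀ {x y} → Adj x y → (sum λ w → count (Bad? x y w)) ≡ 1
  bad≡1 {x} {y} xy = +-cancelʳ-≡ l _ 1 (begin
    (sum λ w → count (Bad? x y w)) + l
      ≡⟨ cong ((sum λ w → count (Bad? x y w)) +_) (walks≡l xy) ⟨
    (sum λ w → count (Bad? x y w)) + walks x y
      ≡⟨ ∑-distrib-+ (λ w → count (Bad? x y w)) (λ w → sum λ z → count (Walk? x y w z)) ⟨
    (sum λ w → count (Bad? x y w) + (sum λ z → count (Walk? x y w z)))
      ≡⟨ (sum-cong-≗ λ w → sym (∑-distrib-+ (λ z → ⟦ Bad? x y w z ⟧) (λ z → count (Walk? x y w z)))) ⟩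
    (sum λ w → sum λ z → ⟦ Bad? x y w z ⟧ + count (Walk? x y w z))
      ≡⟨ (sum-cong-≗ λ w → sum-cong-≗ λ z → bad+walks xy w z) ⟩
    (sum λ w → count (Path? x y w))
      ≡⟨ paths≡ xy ⟩
    d * d
      ≡⟨ 1+l≡d² ⟨
    suc l ∎)
    where open ≡-Reasoning

  bad-exists : ∀ {x y} → Adj x y → ∃ λ w → ∃ λ z → Bad x y w z
  bad-exists {x} {y} xy with sum≢0⇒∃ (λ w → count (Bad? x y w)) (λ e → contradiction (trans (sym e) (bad≡1 xy)) λ ())
  ... | w , h with sum≢0⇒∃ (λ z → ⟦ Bad? x y w z ⟧) h
  ...   | z , h′ = w , z , ⟦⟧-inv (Bad? x y w z) h′

  ends : V → V → V → ℕ
  ends x y z = count (λ w → Bad? x y w z)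

  1≤ends : ∀ {x y w z} → Bad x y w z → 1 ≤ ends x y z
  1≤ends {x} {y} {w} {z} b =
    subst (_≤ ends x y z) (⟦⟧-yes (Bad? x y w z) b) (≤-sum (λ w → ⟦ Bad? x y w z ⟧) w)

  sum-ends : ∀ {x y} → Adj x y → sum (ends x y) ≡ 1
  sum-ends {x} {y} xy = trans (∑-comm (λ z w → ⟦ Bad? x y w z ⟧)) (bad≡1 xy)

  -- Two different ends would each contribute at least one to `sum-ends`, whose value is one.
  end-unique : ∀ {x y w w′ z z′} → Bad x y w z → Bad x y w′ z′ → z ≡ z′
  end-unique {x} {y} {z = z} {z′} b b′ with z Fin.≟ z′
  ... | yes e = e
  ... | no ne = contradiction
    (≤-trans (+-mono-≤ (1≤ends b) (1≤ends b′)) (≤-trans (+-≤-sum (ends x y) ne) (≤-reflexive (sum-ends (proj₁ b)))))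
    λ { (s≤s ()) }

  allEnds : V → V → ℕ
  allEnds x z = sum λ y → ends x y z

  sum-allEnds : ∀ x → sum (allEnds x) ≡ suc d
  sum-allEnds x = trans (∑-comm (λ z y → ends x y z)) (trans (sum-cong-≗ λ y → by-cases y (Adj? x y)) (degree≡ x))
    where
    by-cases : ∀ y (a? : Dec (Adj x y)) → sum (ends x y) ≡ ⟦ a? ⟧
    by-cases y (yes xy) = sum-ends xy
    by-cases y (no ¬xy) = sum≡0 (ends x y) λ z → count≡0 (λ w → Bad? x y w z) λ w (xy , _) → ¬xy xy

  -- If q ∼ z is not at distance 2 from y then y w z q is the bad path starting with y w;
  -- otherwise q is at distance 2 from x, for else the path from x to q via y would be a second bad one.
  far-neighbour-bad : ∀ {x y w z q} → Bad x y w z → Adj z q → ¬ Common x q → Bad y w z q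
  far-neighbour-bad {x} {y} {w} {z} {q} b@(xy , ((yw , w≢x) , (wz , z≢y)) , far) zq ¬xq =
    yw , ((wz , z≢y) , (zq , λ { refl → ¬xq (y , xy , yw) })) , ¬yq
    where
    ¬yq : ¬ Common y q
    ¬yq (p , yp , pq) = Adj⇒≢ zq (end-unique b
      (xy , ((yp , λ { refl → far (q , pq , Adj-sym zq) }) , (pq , λ { refl → no-triangle yw wz zq })) , ¬xq))

  -- Each such q ends a bad path starting with the directed edge from y to w, and that edge has only
  -- one bad end.
  far-neighbours≤1 : ∀ {x y w z} → Bad x y w z → count (λ q → Adj? z q ×-dec ¬? (Common? x q)) ≤ 1
  far-neighbours≤1 {x} {z = z} b = count≤1 (λ q → Adj? z q ×-dec ¬? (Common? x q)) λ q q′ (zq , ¬xq) (zq′ , ¬xq′) →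
    end-unique (far-neighbour-bad b zq ¬xq) (far-neighbour-bad b zq′ ¬xq′)

  -- Of the d + 1 neighbours of z, at most one has no common neighbour with x; each of the others is
  -- the third vertex of a bad path from x to z.
  d≤allEnds : ∀ {x y w z} → Bad x y w z → d ≤ allEnds x z
  d≤allEnds {x} {y} {w} {z} b@(_ , _ , far) = s≤s⁻¹ (begin
    suc d
      ≡⟨ degree≡ z ⟨
    count (Adj? z)
      ≤⟨ sum-mono-≤ (λ q → ⟦ Adj? z q ⟧) (λ q → ⟦ Adj? z q ×-dec ¬? (Common? x q) ⟧ + viaCount q) split ⟩
    (sum λ q → ⟦ Adj? z q ×-dec ¬? (Common? x q) ⟧ + viaCount q)
      ≡⟨ ∑-distrib-+ (λ q → ⟦ Adj? z q ×-dec ¬? (Common? x q) ⟧) viaCount ⟩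
    count (λ q → Adj? z q ×-dec ¬? (Common? x q)) + sum viaCount
      ≤⟨ +-mono-≤ (far-neighbours≤1 b) (≤-reflexive (∑-comm (λ q p → ⟦ Bad? x p q z ⟧))) ⟩
    suc (allEnds x z) ∎)
    where
    open ≤-Reasoning
    viaCount : V → ℕ
    viaCount q = count (λ p → Bad? x p q z)
    split : ∀ q → ⟦ Adj? z q ⟧ ≤ ⟦ Adj? z q ×-dec ¬? (Common? x q) ⟧ + viaCount q
    split q = by-cases (Adj? z q) (Common? x q)
      where
      by-cases : (a? : Dec (Adj z q)) (c? : Dec (Common x q)) → ⟦ a? ⟧ ≤ ⟦ a? ×-dec ¬? c? ⟧ + viaCount q
      by-cases (no _)   _       = z≤n
      by-cases (yes _)  (no _)  = s≤s z≤n
      by-cases (yes zq) (yes (p , xp , pq)) =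
        subst (_≤ viaCount q) (⟦⟧-yes (Bad? x p q z) path) (≤-sum (λ p → ⟦ Bad? x p q z ⟧) p)
        where
        path : Bad x p q z
        -- Turning back at p or at q would make x and z adjacent, which the ends of a bad path are
        -- not.
        path = xp , ((pq , λ { refl → Bad⇒≁ b (Adj-sym zq) }) , (Adj-sym zq , λ { refl → Bad⇒≁ b xp })) , far

  -- Two different ends would need 2d bad paths out of x, but there are only d + 1, and d is at
  -- least 2.
  antipode-unique : ∀ {x y w z y′ w′ z′} → Bad x y w z → Bad x y′ w′ z′ → z ≡ z′
  antipode-unique {x} {z = z} {z′ = z′} b b′ with z Fin.≟ z′
  ... | yes e = e
  ... | no ne = contradiction
    (≤-trans (+-mono-≤ (d≤allEnds b) (d≤allEnds b′)) (≤-trans (+-≤-sum (allEnds x) ne) (≤-reflexive (sum-allEnds x))))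
    (<⇒≱ (+-monoˡ-≤ d 2≤d))

  neighbour : ∀ x → ∃ (Adj x)
  neighbour x with sum≢0⇒∃ (λ y → ⟦ Adj? x y ⟧) (λ e → contradiction (trans (sym e) (degree≡ x)) λ ())
  ... | y , h = y , ⟦⟧-inv (Adj? x y) h

  -- The component of x and its size.

  module Component {x y₀ w₀ antipode : V} (antipode-bad : Bad x y₀ w₀ antipode) where
    -- Reversing a bad path shows that x is the antipode of `antipode`. So the bad path that starts
    -- with `antipode` and q ends at x, and its third vertex is the common neighbour sought.
    antipode-neighbour : ∀ {q} → Adj antipode q → Common x q
    antipode-neighbour {q} zq with bad-exists zq
    ... | p , x′ , b@(_ , ((qp , _) , (px′ , _)) , _) =
      p , subst (λ u → Adj u p) (antipode-unique b (Bad-sym antipode-bad)) (Adj-sym px′) , Adj-sym qp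

    InComponent : V → Set
    InComponent u = Common x u ⊎ (Adj x u ⊎ u ≡ antipode)

    InComponent? : Decidable InComponent
    InComponent? u = Common? x u ⊎-dec (Adj? x u ⊎-dec (u Fin.≟ antipode))

    closed-under-Adj : ∀ {u t} → Adj u t → InComponent u → InComponent t
    closed-under-Adj ut (inj₂ (inj₂ refl)) = inj₁ (antipode-neighbour ut)
    closed-under-Adj {u} ut (inj₂ (inj₁ xu)) = inj₁ (u , xu , ut)
    closed-under-Adj {u} {t} ut (inj₁ (y , xy , yu)) with u Fin.≟ x | Common? x t | t Fin.≟ y
    ... | yes refl | _      | _        = inj₂ (inj₁ ut)
    ... | no u≢x   | yes xt | _        = inj₁ xt
    ... | no u≢x   | no ¬xt | yes refl = inj₂ (inj₁ xy)
    ... | no u≢x   | no ¬xt | no t≢y   =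
      -- Here x, y, u, t is a bad path from x, so t has to be the antipode.
      inj₂ (inj₂ (antipode-unique {y = y} {w = u} (xy , ((yu , u≢x) , (ut , t≢y)) , ¬xt) antipode-bad))

    -- The leading one is x itself. Every other vertex counted has a unique middle vertex by
    -- `common-unique`, so these correspond to the k(k - 1) paths of length two from x.
    count-Common : count (Common? x) ≡ suc (suc d * d)
    count-Common = begin
      count (Common? x)
        ≡⟨ count-≢ (Common? x) {x} (y₀ , proj₁ antipode-bad , Adj-sym (proj₁ antipode-bad)) ⟨
      suc (count (λ u → Common? x u ×-dec ¬? (u Fin.≟ x)))
        ≡⟨ cong suc (sum-cong-≗ split) ⟩
      suc (sum λ u → sum λ y → ⟦ Adj? x y ×-dec AdjBut? y x u ⟧)
        ≡⟨ cong suc (∑-comm (λ u y → ⟦ Adj? x y ×-dec AdjBut? y x u ⟧)) ⟩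
      suc (sum λ y → sum λ u → ⟦ Adj? x y ×-dec AdjBut? y x u ⟧)
        ≡⟨ cong suc (count₂ (Adj? x) (λ y → AdjBut? y x) (degree≡ x) (λ y xy → count-AdjBut (Adj-sym xy))) ⟩
      suc (suc d * d) ∎
      where
      open ≡-Reasoning
      split : ∀ u → ⟦ Common? x u ×-dec ¬? (u Fin.≟ x) ⟧ ≡ count (λ y → Adj? x y ×-dec AdjBut? y x u)
      split u = by-cases (Common? x u ×-dec ¬? (u Fin.≟ x))
        where
        by-cases : (c? : Dec (Common x u × u ≢ x)) → ⟦ c? ⟧ ≡ count (λ y → Adj? x y ×-dec AdjBut? y x u)
        by-cases (yes ((y , xy , yu) , u≢x)) = sym (count≡1 (λ y → Adj? x y ×-dec AdjBut? y x u) (xy , yu , u≢x)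
          λ j (xj , ju , _) → common-unique (≢-sym u≢x) xj ju xy yu)
        by-cases (no ¬c) = sym (count≡0 (λ y → Adj? x y ×-dec AdjBut? y x u)
          λ y (xy , yu , u≢x) → ¬c ((y , xy , yu) , u≢x))

    -- The three kinds of vertex exclude each other: an overlap would give a triangle, a bad path
    -- with a common neighbour of its ends, or one with adjacent ends.
    ⟦InComponent⟧ : ∀ u → ⟦ InComponent? u ⟧ ≡ ⟦ Common? x u ⟧ + (⟦ Adj? x u ⟧ + ⟦ u Fin.≟ antipode ⟧)
    ⟦InComponent⟧ u = by-cases (Common? x u) (Adj? x u) (u Fin.≟ antipode)
      where
      by-cases : (c? : Dec (Common x u)) (a? : Dec (Adj x u)) (z? : Dec (u ≡ antipode)) →
                 ⟦ c? ⊎-dec (a? ⊎-dec z?) ⟧ ≡ ⟦ c? ⟧ + (⟦ a? ⟧ + ⟦ z? ⟧)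
      by-cases (yes (y , xy , yu)) (yes xu) _ = ⊥-elim (no-triangle xy yu (Adj-sym xu))
      by-cases (yes c) _ (yes refl)           = ⊥-elim (proj₂ (proj₂ antipode-bad) c)
      by-cases _ (yes xu) (yes refl)          = ⊥-elim (Bad⇒≁ antipode-bad xu)
      by-cases (yes _) (no _) (no _)          = refl
      by-cases (no _) (yes _) (no _)          = refl
      by-cases (no _) (no _) (yes _)          = refl
      by-cases (no _) (no _) (no _)           = refl

    -- With k = d + 1 this number is k² + 2.
    component-size : count InComponent? ≡ suc (suc d * d) + (suc d + 1)
    component-size = begin
      count InComponent?
        ≡⟨ sum-cong-≗ ⟦InComponent⟧ ⟩
      (sum λ u → ⟦ Common? x u ⟧ + (⟦ Adj? x u ⟧ + ⟦ u Fin.≟ antipode ⟧))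
        ≡⟨ ∑-distrib-+ (λ u → ⟦ Common? x u ⟧) (λ u → ⟦ Adj? x u ⟧ + ⟦ u Fin.≟ antipode ⟧) ⟩
      count (Common? x) + (sum λ u → ⟦ Adj? x u ⟧ + ⟦ u Fin.≟ antipode ⟧)
        ≡⟨ cong (count (Common? x) +_) (∑-distrib-+ (λ u → ⟦ Adj? x u ⟧) (λ u → ⟦ u Fin.≟ antipode ⟧)) ⟩
      count (Common? x) + (count (Adj? x) + count (Fin._≟ antipode))
        ≡⟨ cong₂ _+_ count-Common (cong₂ _+_ (degree≡ x) (count≡1 (Fin._≟ antipode) refl (λ j e → e))) ⟩
      suc (suc d * d) + (suc d + 1) ∎
      where open ≡-Reasoning

-- Divisibility by 5 from rotation of 5-tuples.

minimum : ∀ {n v} (t : Fin (suc n) → Fin v) → ∃ λ i → ∀ j → t i Fin.≤ t j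
minimum {zero}  t = 0F , λ { 0F → ≤-refl }
minimum {suc n} t with minimum (t ∘ suc)
... | i , ti≤ with Fin.≤-total (t 0F) (t (suc i))
...   | inj₁ t0≤ = 0F , λ { 0F → ≤-refl ; (suc j) → ≤-trans t0≤ (ti≤ j) }
...   | inj₂ ≤t0 = suc i , λ { 0F → ≤t0 ; (suc j) → ti≤ j }

module _ {v : ℕ} where
  private V = Fin v

  sum₅ : (V → V → V → V → V → ℕ) → ℕ
  sum₅ f = sum λ a → sum λ b → sum λ c → sum λ d → sum λ e → f a b c d e

  sum₅-cong : ∀ {f g} → (∀ a b c d e → f a b c d e ≡ g a b c d e) → sum₅ f ≡ sum₅ g
  sum₅-cong h = sum-cong-≗ λ a → sum-cong-≗ λ b → sum-cong-≗ λ c → sum-cong-≗ λ d → sum-cong-≗ λ e → h a b c d e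

  sum₅-+ : ∀ f g → sum₅ (λ a b c d e → f a b c d e + g a b c d e) ≡ sum₅ f + sum₅ g
  sum₅-+ f g = begin
    sum₅ (λ a b c d e → f a b c d e + g a b c d e)
      ≡⟨ (sum-cong-≗ λ a → sum-cong-≗ λ b → sum-cong-≗ λ c → sum-cong-≗ λ d → ∑-distrib-+ (f a b c d) (g a b c d)) ⟩
    (sum λ a → sum λ b → sum λ c → sum λ d → sum (f a b c d) + sum (g a b c d))
      ≡⟨ (sum-cong-≗ λ a → sum-cong-≗ λ b → sum-cong-≗ λ c →
            ∑-distrib-+ (λ d → sum (f a b c d)) (λ d → sum (g a b c d))) ⟩
    (sum λ a → sum λ b → sum λ c → (sum λ d → sum (f a b c d)) + (sum λ d → sum (g a b c d)))
      ≡⟨ (sum-cong-≗ λ a → sum-cong-≗ λ b →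
            ∑-distrib-+ (λ c → sum λ d → sum (f a b c d)) (λ c → sum λ d → sum (g a b c d))) ⟩
    (sum λ a → sum λ b → (sum λ c → sum λ d → sum (f a b c d)) + (sum λ c → sum λ d → sum (g a b c d)))
      ≡⟨ (sum-cong-≗ λ a → ∑-distrib-+ (λ b → sum λ c → sum λ d → sum (f a b c d))
                                       (λ b → sum λ c → sum λ d → sum (g a b c d))) ⟩
    (sum λ a → (sum λ b → sum λ c → sum λ d → sum (f a b c d)) + (sum λ b → sum λ c → sum λ d → sum (g a b c d)))
      ≡⟨ ∑-distrib-+ (λ a → sum λ b → sum λ c → sum λ d → sum (f a b c d))
                     (λ a → sum λ b → sum λ c → sum λ d → sum (g a b c d)) ⟩
    sum₅ f + sum₅ g ∎
    where open ≡-Reasoning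

  rot : (V → V → V → V → V → ℕ) → V → V → V → V → V → ℕ
  rot f a b c d e = f b c d e a

  -- The outermost sum is carried inwards past the other four, one exchange at a time.
  sum₅-rot : ∀ f → sum₅ (rot f) ≡ sum₅ f
  sum₅-rot f = begin
    (sum λ a → sum λ b → sum λ c → sum λ d → sum λ e → f b c d e a)
      ≡⟨ ∑-comm (λ a b → sum λ c → sum λ d → sum λ e → f b c d e a) ⟩
    (sum λ b → sum λ a → sum λ c → sum λ d → sum λ e → f b c d e a)
      ≡⟨ (sum-cong-≗ λ b → ∑-comm (λ a c → sum λ d → sum λ e → f b c d e a)) ⟩
    (sum λ b → sum λ c → sum λ a → sum λ d → sum λ e → f b c d e a)
      ≡⟨ (sum-cong-≗ λ b → sum-cong-≗ λ c → ∑-comm (λ a d → sum λ e → f b c d e a)) ⟩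
    (sum λ b → sum λ c → sum λ d → sum λ a → sum λ e → f b c d e a)
      ≡⟨ (sum-cong-≗ λ b → sum-cong-≗ λ c → sum-cong-≗ λ d → ∑-comm (λ a e → f b c d e a)) ⟩
    sum₅ f ∎
    where open ≡-Reasoning

  -- The trailing `+ 0` gives the summand the form to which a `count` over `Fin 5` unfolds, as
  -- needed when the rotations are indexed by `LeastAt`.
  sum₅-rotations : ∀ f → sum₅ (λ a b c d e →
    f a b c d e + (f b c d e a + (f c d e a b + (f d e a b c + (f e a b c d + 0))))) ≡ sum₅ f * 5
  sum₅-rotations f = begin
    sum₅ (λ a b c d e → f a b c d e + (f b c d e a + (f c d e a b + (f d e a b c + (f e a b c d + 0)))))
      ≡⟨ (sum₅-cong λ a b c d e → cong (λ r → f a b c d e + (f b c d e a + (f c d e a b + (f d e a b c + r))))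
           (+-identityʳ _)) ⟩
    sum₅ (λ a b c d e → f a b c d e + (f₁ a b c d e + (f₂ a b c d e + (f₃ a b c d e + f₄ a b c d e))))
      ≡⟨ sum₅-+ f (λ a b c d e → f₁ a b c d e + (f₂ a b c d e + (f₃ a b c d e + f₄ a b c d e))) ⟩
    s + sum₅ (λ a b c d e → f₁ a b c d e + (f₂ a b c d e + (f₃ a b c d e + f₄ a b c d e)))
      ≡⟨ cong (s +_) (sum₅-+ f₁ (λ a b c d e → f₂ a b c d e + (f₃ a b c d e + f₄ a b c d e))) ⟩
    s + (sum₅ f₁ + sum₅ (λ a b c d e → f₂ a b c d e + (f₃ a b c d e + f₄ a b c d e)))
      ≡⟨ cong₂ (λ p q → s + (p + q)) e₁ (sum₅-+ f₂ (λ a b c d e → f₃ a b c d e + f₄ a b c d e)) ⟩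
    s + (s + (sum₅ f₂ + sum₅ (λ a b c d e → f₃ a b c d e + f₄ a b c d e)))
      ≡⟨ cong₂ (λ p q → s + (s + (p + q))) e₂ (sum₅-+ f₃ f₄) ⟩
    s + (s + (s + (sum₅ f₃ + sum₅ f₄)))
      ≡⟨ cong₂ (λ p q → s + (s + (s + (p + q)))) e₃ e₄ ⟩
    s + (s + (s + (s + s)))
      ≡⟨ cong (λ r → s + (s + (s + (s + r)))) (+-identityʳ s) ⟨
    5 * s
      ≡⟨ *-comm 5 s ⟩
    s * 5 ∎
    where
    open ≡-Reasoning
    f₁ f₂ f₃ f₄ : V → V → V → V → V → ℕ
    f₁ = rot f
    f₂ = rot f₁
    f₃ = rot f₂
    f₄ = rot f₃
    s : ℕ
    s = sum₅ f
    e₁ : sum₅ f₁ ≡ s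
    e₁ = sum₅-rot f
    e₂ : sum₅ f₂ ≡ s
    e₂ = trans (sum₅-rot f₁) e₁
    e₃ : sum₅ f₃ ≡ s
    e₃ = trans (sum₅-rot f₂) e₂
    e₄ : sum₅ f₄ ≡ s
    e₄ = trans (sum₅-rot f₃) e₃

  -- Among the five rotations of a tuple of distinct entries, exactly one starts with the least entry.
  5∣rotation-invariant : (P : V → V → V → V → V → Set) (P? : ∀ a b c d e → Dec (P a b c d e)) →
    (∀ {a b c d e} → P a b c d e → P b c d e a) →
    (∀ {a b c d e} → P a b c d e → ∀ {i j} → ⟨ a , b , c , d , e ⟩ i ≡ ⟨ a , b , c , d , e ⟩ j → i ≡ j) →
    5 ∣ sum₅ (λ a b c d e → ⟦ P? a b c d e ⟧)
  5∣rotation-invariant P P? P-rot P-inj = divides (sum₅ m) (trans (sum₅-cong pointwise) (sum₅-rotations m))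
    where
    Least : V → V → V → V → V → Set
    Least a b c d e = P a b c d e × (a Fin.< b × a Fin.< c × a Fin.< d × a Fin.< e)
    Least? : ∀ a b c d e → Dec (Least a b c d e)
    Least? a b c d e = P? a b c d e ×-dec ((a Fin.<? b) ×-dec (a Fin.<? c) ×-dec (a Fin.<? d) ×-dec (a Fin.<? e))
    m : V → V → V → V → V → ℕ
    m a b c d e = ⟦ Least? a b c d e ⟧

    P-rot₂ : ∀ {a b c d e} → P a b c d e → P c d e a b
    P-rot₂ p = P-rot (P-rot p)
    P-rot₃ : ∀ {a b c d e} → P a b c d e → P d e a b c
    P-rot₃ p = P-rot (P-rot₂ p)
    P-rot₄ : ∀ {a b c d e} → P a b c d e → P e a b c d
    P-rot₄ p = P-rot (P-rot₃ p)

    pointwise : ∀ a b c d e →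
      ⟦ P? a b c d e ⟧ ≡ m a b c d e + (m b c d e a + (m c d e a b + (m d e a b c + (m e a b c d + 0))))
    pointwise a b c d e = by-cases (P? a b c d e)
      where
      t : Fin 5 → V
      t = ⟨ a , b , c , d , e ⟩
      LeastAt : Fin 5 → Set
      LeastAt i = Least (t i) (t (next i)) (t (next (next i))) (t (next (next (next i)))) (t (next (next (next (next i)))))
      LeastAt? : Decidable LeastAt
      LeastAt? i = Least? (t i) (t (next i)) (t (next (next i))) (t (next (next (next i)))) (t (next (next (next (next i)))))

      leastAt⇒P : ∀ i → LeastAt i → P a b c d e
      leastAt⇒P 0F (p , _) = p
      leastAt⇒P 1F (p , _) = P-rot₄ p
      leastAt⇒P 2F (p , _) = P-rot₃ p
      leastAt⇒P 3F (p , _) = P-rot₂ p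
      leastAt⇒P 4F (p , _) = P-rot p

      leastAt-< : ∀ {i j} → LeastAt i → j ≢ i → t i Fin.< t j
      leastAt-< {i} {j} (_ , l₁ , l₂ , l₃ , l₄) j≢i with Fin5-orbit i j
      ... | inj₁ e                              = contradiction e j≢i
      ... | inj₂ (inj₁ refl)                    = l₁
      ... | inj₂ (inj₂ (inj₁ refl))             = l₂
      -- Position i lies two steps after j, so three more steps from i arrive at j again; the next
      -- case is the same with one step and four.
      ... | inj₂ (inj₂ (inj₂ (inj₁ refl)))      = subst (λ k → t (next (next j)) Fin.< t k) (next⁵ j) l₃
      ... | inj₂ (inj₂ (inj₂ (inj₂ refl)))      = subst (λ k → t (next j) Fin.< t k) (next⁵ j) l₄

      minimum⇒leastAt : P a b c d e → ∀ i → (∀ j → t i Fin.≤ t j) → LeastAt i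
      minimum⇒leastAt p = λ
        { 0F h → p        , lt h (λ ()) , lt h (λ ()) , lt h (λ ()) , lt h (λ ())
        ; 1F h → P-rot p  , lt h (λ ()) , lt h (λ ()) , lt h (λ ()) , lt h (λ ())
        ; 2F h → P-rot₂ p , lt h (λ ()) , lt h (λ ()) , lt h (λ ()) , lt h (λ ())
        ; 3F h → P-rot₃ p , lt h (λ ()) , lt h (λ ()) , lt h (λ ()) , lt h (λ ())
        ; 4F h → P-rot₄ p , lt h (λ ()) , lt h (λ ()) , lt h (λ ()) , lt h (λ ()) }
        where
        lt : ∀ {i j} → (∀ j → t i Fin.≤ t j) → i ≢ j → t i Fin.< t j
        lt {i} {j} h i≢j = Fin.≤∧≢⇒< (h j) (i≢j ∘ P-inj p)

      by-cases : (p? : Dec (P a b c d e)) → ⟦ p? ⟧ ≡ count LeastAt?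
      by-cases (no ¬p) = sym (count≡0 LeastAt? λ i q → ¬p (leastAt⇒P i q))
      by-cases (yes p) with minimum t
      ... | i , ti≤ = sym (count≡1 LeastAt? (minimum⇒leastAt p i ti≤) unique)
        where
        unique : ∀ j → LeastAt j → j ≡ i
        unique j q with i Fin.≟ j
        ... | yes e  = sym e
        ... | no i≢j = contradiction (ti≤ j) (<⇒≱ (leastAt-< {j} {i} q i≢j))

-- Closed 5-walks inside a set closed under adjacency.

module _ {v : ℕ} (G : Graph v) (girth : HasGirth G 5) {k l : ℕ} {C : Fin v → Set} (C? : Decidable C)
         (C-closed : ∀ {x y} → Graph.Adj G x y → C x → C y)
         (degree≡ : ∀ x → count (Graph.Adj? G x) ≡ k)
         (walks≡l : ∀ {x y} → Graph.Adj G x y → Girth5.walks G girth x y ≡ l) where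
  open Girth5 G girth

  -- The number is that of closed 5-walks starting in `C`. Closure of `C` makes them invariant under
  -- rotation, and girth 5 makes their entries distinct, so rotation acts freely.
  5∣closed-walks : 5 ∣ count C? * k * l
  5∣closed-walks = subst (5 ∣_) total (5∣rotation-invariant ClosedWalk ClosedWalk? closedWalk-rot closedWalk-inj)
    where
    ClosedWalk : (x y w z q : Fin v) → Set
    ClosedWalk x y w z q = C x × (Adj x y × Walk x y w z q)
    ClosedWalk? : ∀ x y w z q → Dec (ClosedWalk x y w z q)
    ClosedWalk? x y w z q = C? x ×-dec (Adj? x y ×-dec Walk? x y w z q)

    closedWalk-rot : ∀ {x y w z q} → ClosedWalk x y w z q → ClosedWalk y w z q x
    closedWalk-rot (cx , xy , yw , wz , zq , qx) = C-closed xy cx , yw , wz , zq , qx , xy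

    closedWalk-inj : ∀ {x y w z q} → ClosedWalk x y w z q →
      ∀ {i j} → ⟨ x , y , w , z , q ⟩ i ≡ ⟨ x , y , w , z , q ⟩ j → i ≡ j
    closedWalk-inj (_ , xy , yw , wz , zq , qx) =
      closed-injective λ { 0F → xy ; 1F → yw ; 2F → wz ; 3F → zq ; 4F → qx }

    zeros : (sum λ (w : Fin v) → sum λ (z : Fin v) → sum λ (q : Fin v) → 0) ≡ 0
    zeros = sum≡0 (λ (w : Fin v) → sum λ (z : Fin v) → sum λ (q : Fin v) → 0) λ _ →
      sum≡0 (λ (z : Fin v) → sum λ (q : Fin v) → 0) λ _ → sum≡0 {v} (λ _ → 0) λ _ → refl

    inner : ∀ x y → (sum λ w → sum λ z → count (ClosedWalk? x y w z)) ≡ ⟦ C? x ×-dec Adj? x y ⟧ * l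
    inner x y = by-cases (C? x) (Adj? x y)
      where
      by-cases : (c? : Dec (C x)) (a? : Dec (Adj x y)) →
        (sum λ w → sum λ z → sum λ q → ⟦ c? ×-dec (a? ×-dec Walk? x y w z q) ⟧) ≡ ⟦ c? ×-dec a? ⟧ * l
      by-cases (yes _) (yes xy) = trans (walks≡l xy) (sym (*-identityˡ l))
      by-cases (yes _) (no _)   = zeros
      by-cases (no _)  _        = zeros

    total : sum₅ (λ x y w z q → ⟦ ClosedWalk? x y w z q ⟧) ≡ count C? * k * l
    total = begin
      sum₅ (λ x y w z q → ⟦ ClosedWalk? x y w z q ⟧)
        ≡⟨ (sum-cong-≗ λ x → trans (sum-cong-≗ (inner x)) (sum-⟦⟧* (λ y → C? x ×-dec Adj? x y) l)) ⟩
      (sum λ x → count (λ y → C? x ×-dec Adj? x y) * l)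
        ≡⟨ *-distribʳ-sum l (λ x → count (λ y → C? x ×-dec Adj? x y)) ⟨
      (sum λ x → count (λ y → C? x ×-dec Adj? x y)) * l
        ≡⟨ cong (_* l) (count₂ C? Adj? refl (λ x _ → degree≡ x)) ⟩
      count C? * k * l ∎
      where open ≡-Reasoning

-- The divisibility condition and its two contradictions.

egr-5∣ : ∀ {v d l} → 2 ≤ d → suc l ≡ d * d → 0 < v → egr v (suc d) 5 l →
         5 ∣ (suc (suc d * d) + (suc d + 1)) * suc d * l
-- Positivity of v supplies a vertex; an edge at it starts the bad path that fixes the component and
-- its antipode.
egr-5∣ {v} {d} {l} 2≤d 1+l≡d² 0<v (G , E) = conclude (bad-exists (proj₂ (neighbour (fromℕ< 0<v))))
  where
  open IsEdgeGirthRegular E renaming (count to through)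
  degree≡ : ∀ x → count (Graph.Adj? G x) ≡ suc d
  degree≡ x = trans (sym (length-filter-tabulate (Graph.Adj? G x) id)) (regular x)
  walks≡l : ∀ {x y} → Graph.Adj G x y → Girth5.walks G girth x y ≡ l
  walks≡l {x} {y} xy = Girth5.walks≡ G girth (through x y xy) xy
  open Defect1 G girth d l 2≤d 1+l≡d² degree≡ walks≡l
  conclude : ∀ {x y} → (∃ λ w → ∃ λ z → Bad x y w z) → 5 ∣ (suc (suc d * d) + (suc d + 1)) * suc d * l
  conclude (_ , _ , b) = subst (λ c → 5 ∣ c * suc d * l) component-size
    (5∣closed-walks G girth InComponent? closed-under-Adj degree≡ walks≡l)
    where open Component b

corollary2 : (∀ (v : ℕ) → 0 < v → ¬ egr v 4 5 8) × (∀ (v : ℕ) → 0 < v → ¬ egr v 6 5 24)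
corollary2 =
  -- The factors 18 and 38 are the component sizes k² + 2 for k = 4 and k = 6; neither product is a
  -- multiple of 5.
  (λ v 0<v e → from-no (5 ∣? 18 * 4 * 8)  (egr-5∣ {d = 3} (s≤s (s≤s z≤n)) refl 0<v e)) ,
  (λ v 0<v e → from-no (5 ∣? 38 * 6 * 24) (egr-5∣ {d = 5} (s≤s (s≤s z≤n)) refl 0<v e))
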